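{- Let $G_1=(V_1,E_1)$ and $G_2=(V_2,E_2)$ be isomorphic graphs, let $f:V_1\to V_2$ be a graph isomorphism, and let $v\in V_1$ and $w\in V_2$ be vertices with $f(v)=w$. Then the vertex signatures of $v$ in $G_1$ and of $w$ in $G_2$, as computed by the RSVP procedure, are identical: $\mathbb{S}_{G_1}(v)=\mathbb{S}_{G_2}(w)$.
   Context: Graphs are finite, simple, undirected, unlabeled and unweighted. An isomorphism $f:V_1\to V_2$ is a bijection such that $\{u,v\}\in E_1$ if and only if $\{f(u),f(v)\}\in E_2$. For a graph $G=(V,E)$, $N(v)$ denotes the set of neighbours of $v$ and $d_G(x,y)$ the hop distance (length of a shortest path). Fixed data (the same for all graphs): an injective map $\mathcal{P}$ from the nonnegative integers to the set of primes $\ge 3$; a real constant $\kappa$ used as a convention below. The RSVP vertex signature. Let $G=(V,E)$ have $n$ vertices. (1) Pairwise distances: compute $d_G(x,y)$ for all $x,y\in V$ by breadth-first search (BFS) from each vertex. (2) Multi-source reachability: for $v\in V$, let $G'=G-v$ ($v$ and its incident edges are deleted). For each start vertex $s\in N(v)$, run a modified BFS on $G'$ from $s$: each vertex is inserted in the queue and visited once, as in ordinary BFS, but when a vertex $u$ is visited, every edge $\{u,x\}$ of $G'$ incident to $u$ is considered (even if $x$ was already discovered or visited), and an entry "$x$ is reached with hop-distance $d_{G'}(s,u)+1$ from $s$ via the immediate parent $u$" is recorded for $x$. (3) Aggregation: merge the entries over all $s\in N(v)$, measuring hops from $v$ (i.e. adding $1$ for the step from $v$ to $s$). Thus, for $t\in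 V\setminus\{v\}$ and an integer $h\ge 2$, the parent list of $t$ at hop-distance $h$ from $v$ is the set $$pl_h(v\to t)=\{u : \{u,t\}\in E(G'),\ \exists s\in N(v)\ \text{with}\ d_{G'}(s,u)+2=h\},$$ and $pl_1(v\to t)=\{v\}$ if $t\in N(v)$, $pl_1(v\to t)=\emptyset$ otherwise. Let $\mathcal{HP}_{v\to t}$ be the collection of all triples $\langle h@c, pl\rangle$ with $pl=pl_h(v\to t)\neq\emptyset$ and $c=|pl|$ (the number of distinct immediate parents). If there is no such $h$ (in particular for $t=v$, or $t$ not reachable from $v$), set $\mathcal{HP}_{v\to t}=\{\langle 0@0,\emptyset\rangle\}$. (4) Signature: for a finite set $pl$ of vertices with at least two elements, $AvPD(pl)$ is the average of $d_G(x,y)$ over all unordered pairs of distinct $x,y\in pl$; if $|pl|\le 1$, $AvPD(pl)=\kappa$. Put $$\mathcal{S}(v\to t)=\prod_{\langle h@c,pl\rangle\in\mathcal{HP}_{v\to t}} AvPD(pl)\cdot \mathcal{P}(h)^{c}.$$ The signature $\mathbb{S}_G(v)$ is the sequence of the $n$ real numbers $\mathcal{S}(v\to t)$, $t\in V$, sorted in nondecreasing order. -}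

module Defs where

open import Data.Bool using (if_then_else_)
open import Data.Fin using (Fin)
open import Data.Fin.Properties using (any?) renaming (_≟_ to _≟ᶠ_)
open import Data.Integer using (+_)
open import Data.List using
  (List; []; _∷_; _++_; allFin; concatMap; filter; foldr; head; length; map; upTo)
open import Data.List.Relation.Binary.Pointwise using (Pointwise)
open import Data.List.Relation.Unary.Linked as Linked using (_∷_)
import Data.List.Relation.Unary.Sorted.TotalOrder as SortedList
import Data.List.Sort.InsertionSort as InsertionSort
open import Data.Maybe using (Maybe; just; fromMaybe)
open import Data.Maybe.Properties using (≡-dec)
open import Data.Nat as ℕ using (ℕ; zero; suc)
open import Data.Nat.ListAction using (sum)
import Data.Nat.Properties as ℕ
open import Data.Product using (∃-syntax; _×_; _,_)
open import Data.Rational as ℚ using (ℚ; 0ℚ; 1ℚ; ∣_∣)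
import Data.Rational.Properties as ℚ
open import Data.Rational.Solver using (module +-*-Solver)
open import Data.Sum using (inj₁; inj₂)
open import Function.Bundles using (_⤖_; _⇔_; module Bijection)
open import Relation.Binary.Bundles using (module DecTotalOrder)
open import Relation.Binary.PropositionalEquality as ≡ using (_≡_; _≢_; cong; cong₂; subst)
open import Relation.Nullary using (¬_; Dec; yes; no; ¬?)
open import Relation.Nullary.Decidable using (_×-dec_; dec-false; dec-true; map′)

-- Reals are Cauchy sequences of rationals; _≃_ is their equality.

Near : ℚ → ℚ → ℚ → Set
Near ε p q = ∣ p ℚ.- q ∣ ℚ.< ε

record ℝ : Set where
  field
    approx : ℕ → ℚ
    cauchy : ∀ ε → 0ℚ ℚ.< ε → ∃[ N ] (∀ m n → N ℕ.≤ m → N ℕ.≤ n →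
             Near ε (approx m) (approx n))

open ℝ public

infix 4 _≃_

_≃_ : ℝ → ℝ → Set
x ≃ y = ∀ ε → 0ℚ ℚ.< ε → ∃[ N ] (∀ n → N ℕ.≤ n → Near ε (approx x n) (approx y n))

private
  near⇒< : ∀ {ε} p q → Near ε p q → p ℚ.< q ℚ.+ ε
  near⇒< {ε} p q p~q = begin-strict
    p                   ≡⟨ solve 2 (λ p q → p := q :+ (p :- q)) ≡.refl p q ⟩
    q ℚ.+ (p ℚ.- q)     ≤⟨ ℚ.+-monoʳ-≤ q (p≤∣p∣ (p ℚ.- q)) ⟩
    q ℚ.+ ∣ p ℚ.- q ∣   <⟨ ℚ.+-monoʳ-< q p~q ⟩
    q ℚ.+ ε             ∎
    where
    open ℚ.≤-Reasoning
    open +-*-Solver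
    p≤∣p∣ : ∀ p → p ℚ.≤ ∣ p ∣
    p≤∣p∣ p with ℚ.≤-total 0ℚ p
    ... | inj₁ 0≤p = ℚ.≤-reflexive (≡.sym (ℚ.0≤p⇒∣p∣≡p 0≤p))
    ... | inj₂ p≤0 = ℚ.≤-trans p≤0 (ℚ.0≤∣p∣ p)

  near-sym : ∀ {ε} p q → Near ε p q → Near ε q p
  near-sym {ε} p q = subst (ℚ._< ε) (≡.trans (≡.sym (ℚ.∣-p∣≡∣p∣ (p ℚ.- q)))
    (cong ∣_∣ (solve 2 (λ p q → :- (p :- q) := q :- p) ≡.refl p q)))
    where open +-*-Solver

  <⇒near : ∀ {ε} p q → p ℚ.< q ℚ.+ ε → q ℚ.< p ℚ.+ ε → Near ε p q
  <⇒near {ε} p q p< q< with ℚ.∣p∣≡p∨∣p∣≡-p (p ℚ.- q)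
  ... | inj₁ e = subst (ℚ._< ε) (≡.sym e) (≡.subst₂ ℚ._<_ ≡.refl
      (solve 2 (λ q ε → (q :+ ε) :- q := ε) ≡.refl q ε) (ℚ.+-monoˡ-< (ℚ.- q) p<))
    where open +-*-Solver
  ... | inj₂ e = subst (ℚ._< ε) (≡.sym e) (≡.subst₂ ℚ._<_
      (solve 2 (λ p q → q :- p := :- (p :- q)) ≡.refl p q)
      (solve 2 (λ p ε → (p :+ ε) :- p := ε) ≡.refl p ε) (ℚ.+-monoˡ-< (ℚ.- p) q<))
    where open +-*-Solver

  ⊓-step : ∀ {ε} p q r s → p ℚ.< r ℚ.+ ε → q ℚ.< s ℚ.+ ε → p ℚ.⊓ q ℚ.< (r ℚ.⊓ s) ℚ.+ ε
  ⊓-step {ε} p q r s p< q< with ℚ.⊓-sel r s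
  ... | inj₁ e = subst (λ x → p ℚ.⊓ q ℚ.< x ℚ.+ ε) (≡.sym e) (ℚ.≤-<-trans (ℚ.p⊓q≤p p q) p<)
  ... | inj₂ e = subst (λ x → p ℚ.⊓ q ℚ.< x ℚ.+ ε) (≡.sym e) (ℚ.≤-<-trans (ℚ.p⊓q≤q p q) q<)

  ⊔-step : ∀ {ε} p q r s → p ℚ.< r ℚ.+ ε → q ℚ.< s ℚ.+ ε → p ℚ.⊔ q ℚ.< (r ℚ.⊔ s) ℚ.+ ε
  ⊔-step {ε} p q r s p< q< with ℚ.⊔-sel p q
  ... | inj₁ e = subst (ℚ._< (r ℚ.⊔ s) ℚ.+ ε) (≡.sym e)
                   (ℚ.<-≤-trans p< (ℚ.+-monoˡ-≤ ε (ℚ.p≤p⊔q r s)))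
  ... | inj₂ e = subst (ℚ._< (r ℚ.⊔ s) ℚ.+ ε) (≡.sym e)
                   (ℚ.<-≤-trans q< (ℚ.+-monoˡ-≤ ε (ℚ.p≤q⊔p r s)))

  Eventually : (ℕ → ℕ → Set) → Set
  Eventually P = ∃[ N ] (∀ m n → N ℕ.≤ m → N ℕ.≤ n → P m n)

  combine : ∀ (P Q R : ℕ → ℕ → Set) → (∀ m n → P m n → Q m n → R m n) →
            Eventually P → Eventually Q → Eventually R
  combine P Q R r (M , p) (N , q) = M ℕ.⊔ N , λ m n K≤m K≤n → r m n
    (p m n (ℕ.≤-trans (ℕ.m≤m⊔n M N) K≤m) (ℕ.≤-trans (ℕ.m≤m⊔n M N) K≤n))
    (q m n (ℕ.≤-trans (ℕ.m≤n⊔m M N) K≤m) (ℕ.≤-trans (ℕ.m≤n⊔m M N) K≤n))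

  Close : ℚ → (ℕ → ℚ) → ℕ → ℕ → Set
  Close ε f m n = Near ε (f m) (f n)

  ⊓-near : ∀ {ε} p q r s → Near ε p r → Near ε q s → Near ε (p ℚ.⊓ q) (r ℚ.⊓ s)
  ⊓-near p q r s p~r q~s = <⇒near (p ℚ.⊓ q) (r ℚ.⊓ s)
    (⊓-step p q r s (near⇒< p r p~r) (near⇒< q s q~s))
    (⊓-step r s p q (near⇒< r p (near-sym p r p~r)) (near⇒< s q (near-sym q s q~s)))

  ⊔-near : ∀ {ε} p q r s → Near ε p r → Near ε q s → Near ε (p ℚ.⊔ q) (r ℚ.⊔ s)
  ⊔-near p q r s p~r q~s = <⇒near (p ℚ.⊔ q) (r ℚ.⊔ s)
    (⊔-step p q r s (near⇒< p r p~r) (near⇒< q s q~s))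
    (⊔-step r s p q (near⇒< r p (near-sym p r p~r)) (near⇒< s q (near-sym q s q~s)))

  bounded : ∀ x → ∃[ B ] (0ℚ ℚ.< B × ∃[ N ] (∀ m (n : ℕ) → N ℕ.≤ m → N ℕ.≤ n →
            ∣ approx x m ∣ ℚ.≤ B))
  bounded x with cauchy x 1ℚ (ℚ.positive⁻¹ 1ℚ)
  ... | N , near = ∣ c ∣ ℚ.+ 1ℚ
                 , ℚ.+-mono-≤-< (ℚ.0≤∣p∣ c) (ℚ.positive⁻¹ 1ℚ)
                 , N , λ m _ N≤m _ → bound (approx x m) (near m N N≤m ℕ.≤-refl)
    where
    c = approx x N
    bound : ∀ a → Near 1ℚ a c → ∣ a ∣ ℚ.≤ ∣ c ∣ ℚ.+ 1ℚ
    bound a a~c = begin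
      ∣ a ∣                    ≡⟨ cong ∣_∣ (solve 2 (λ a c → a := c :+ (a :- c)) ≡.refl a c) ⟩
      ∣ c ℚ.+ (a ℚ.- c) ∣      ≤⟨ ℚ.∣p+q∣≤∣p∣+∣q∣ c (a ℚ.- c) ⟩
      ∣ c ∣ ℚ.+ ∣ a ℚ.- c ∣    ≤⟨ ℚ.+-monoʳ-≤ ∣ c ∣ (ℚ.<⇒≤ a~c) ⟩
      ∣ c ∣ ℚ.+ 1ℚ             ∎
      where
      open ℚ.≤-Reasoning
      open +-*-Solver

  *-near : ∀ {A B δ} p q r s → 0ℚ ℚ.< A → 0ℚ ℚ.< B → ∣ p ∣ ℚ.≤ A → ∣ s ∣ ℚ.≤ B →
           Near δ p r → Near δ q s → Near ((A ℚ.+ B) ℚ.* δ) (p ℚ.* q) (r ℚ.* s)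
  *-near {A} {B} {δ} p q r s 0<A 0<B p≤A s≤B p~r q~s = begin-strict
    ∣ p ℚ.* q ℚ.- r ℚ.* s ∣
      ≡⟨ cong ∣_∣ (solve 4 (λ p q r s →
           p :* q :- r :* s := p :* (q :- s) :+ s :* (p :- r)) ≡.refl p q r s) ⟩
    ∣ p ℚ.* (q ℚ.- s) ℚ.+ s ℚ.* (p ℚ.- r) ∣
      ≤⟨ ℚ.∣p+q∣≤∣p∣+∣q∣ (p ℚ.* (q ℚ.- s)) (s ℚ.* (p ℚ.- r)) ⟩
    ∣ p ℚ.* (q ℚ.- s) ∣ ℚ.+ ∣ s ℚ.* (p ℚ.- r) ∣
      <⟨ ℚ.+-mono-< (term p (q ℚ.- s) 0<A p≤A q~s) (term s (p ℚ.- r) 0<B s≤B p~r) ⟩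
    A ℚ.* δ ℚ.+ B ℚ.* δ
      ≡⟨ ℚ.*-distribʳ-+ δ A B ⟨
    (A ℚ.+ B) ℚ.* δ ∎
    where
    open ℚ.≤-Reasoning
    open +-*-Solver
    term : ∀ {C} a d → 0ℚ ℚ.< C → ∣ a ∣ ℚ.≤ C → ∣ d ∣ ℚ.< δ → ∣ a ℚ.* d ∣ ℚ.< C ℚ.* δ
    term {C} a d 0<C a≤C d<δ = begin-strict
      ∣ a ℚ.* d ∣       ≡⟨ ℚ.∣p*q∣≡∣p∣*∣q∣ a d ⟩
      ∣ a ∣ ℚ.* ∣ d ∣   ≤⟨ ℚ.*-monoʳ-≤-nonNeg ∣ d ∣ {{ℚ.nonNegative (ℚ.0≤∣p∣ d)}} a≤C ⟩
      C ℚ.* ∣ d ∣       <⟨ ℚ.*-monoʳ-<-pos C {{ℚ.positive 0<C}} d<δ ⟩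
      C ℚ.* δ           ∎

  scale : ∀ c ε → 0ℚ ℚ.< c → 0ℚ ℚ.< ε → ∃[ δ ] (0ℚ ℚ.< δ × c ℚ.* δ ≡ ε)
  scale c ε 0<c 0<ε = δ , 0<δ , cδ≡ε
    where
    instance
      c>0 : ℚ.Positive c
      c>0 = ℚ.positive 0<c
      c≢0 : ℚ.NonZero c
      c≢0 = ℚ.pos⇒nonZero c
      ε>0 : ℚ.Positive ε
      ε>0 = ℚ.positive 0<ε
    δ = ℚ.1/ c ℚ.* ε
    0<δ : 0ℚ ℚ.< δ
    0<δ = ℚ.positive⁻¹ δ {{ℚ.pos*pos⇒pos (ℚ.1/ c) {{ℚ.1/pos⇒pos c}} ε}}
    cδ≡ε : c ℚ.* δ ≡ ε
    cδ≡ε = begin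
      c ℚ.* (ℚ.1/ c ℚ.* ε)   ≡⟨ ℚ.*-assoc c (ℚ.1/ c) ε ⟨
      c ℚ.* ℚ.1/ c ℚ.* ε     ≡⟨ cong (ℚ._* ε) (ℚ.*-inverseʳ c) ⟩
      1ℚ ℚ.* ε               ≡⟨ ℚ.*-identityˡ ε ⟩
      ε                      ∎
      where open ≡.≡-Reasoning

  *-eventually : ∀ (x y : ℕ → ℚ) {A B δ ε} → 0ℚ ℚ.< A → 0ℚ ℚ.< B → (A ℚ.+ B) ℚ.* δ ≡ ε →
                 Eventually (λ m _ → ∣ x m ∣ ℚ.≤ A) → Eventually (λ m _ → ∣ y m ∣ ℚ.≤ B) →
                 Eventually (Close δ x) → Eventually (Close δ y) →
                 Eventually (Close ε λ n → x n ℚ.* y n)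
  *-eventually x y {A} {B} {δ} 0<A 0<B ≡.refl x≤A (N , y≤B) x~ y~ =
    combine Bounds Closes (Close ((A ℚ.+ B) ℚ.* δ) λ n → x n ℚ.* y n)
      (λ m n (x≤ , y≤) (x~ , y~) → *-near (x m) (y m) (x n) (y n) 0<A 0<B x≤ y≤ x~ y~)
      (combine (λ m _ → ∣ x m ∣ ℚ.≤ A) (λ _ n → ∣ y n ∣ ℚ.≤ B) Bounds (λ _ _ → _,_)
        x≤A (N , λ m n N≤m N≤n → y≤B n m N≤n N≤m))
      (combine (Close δ x) (Close δ y) Closes (λ _ _ → _,_) x~ y~)
    where
    Bounds Closes : ℕ → ℕ → Set
    Bounds m n = ∣ x m ∣ ℚ.≤ A × ∣ y n ∣ ℚ.≤ B
    Closes m n = Close δ x m n × Close δ y m n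

  *-cauchy : ∀ x y ε → 0ℚ ℚ.< ε → Eventually (Close ε λ n → approx x n ℚ.* approx y n)
  *-cauchy x y ε 0<ε =
    let A , 0<A , x≤A = bounded x
        B , 0<B , y≤B = bounded y
        δ , 0<δ , eq  = scale (A ℚ.+ B) ε (ℚ.+-mono-< 0<A 0<B) 0<ε
    in *-eventually (approx x) (approx y) 0<A 0<B eq x≤A y≤B (cauchy x δ 0<δ) (cauchy y δ 0<δ)

fromℚ : ℚ → ℝ
fromℚ q = record
  { approx = λ _ → q
  ; cauchy = λ ε 0<ε → 0 , λ _ _ _ _ → subst (λ d → ∣ d ∣ ℚ.< ε) (≡.sym (ℚ.+-inverseʳ q)) 0<ε
  }

fromℕ : ℕ → ℝ
fromℕ n = fromℚ (+ n ℚ./ 1)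

infixl 7 _*_ _⊓_
infixl 6 _⊔_

_*_ : ℝ → ℝ → ℝ
x * y = record
  { approx = λ n → approx x n ℚ.* approx y n
  ; cauchy = *-cauchy x y
  }

_⊓_ : ℝ → ℝ → ℝ
x ⊓ y = record
  { approx = λ n → approx x n ℚ.⊓ approx y n
  ; cauchy = λ ε 0<ε → combine (Close ε (approx x)) (Close ε (approx y))
      (Close ε λ n → approx x n ℚ.⊓ approx y n)
      (λ m n → ⊓-near (approx x m) (approx y m) (approx x n) (approx y n))
      (cauchy x ε 0<ε) (cauchy y ε 0<ε)
  }

_⊔_ : ℝ → ℝ → ℝ
x ⊔ y = record
  { approx = λ n → approx x n ℚ.⊔ approx y n
  ; cauchy = λ ε 0<ε → combine (Close ε (approx x)) (Close ε (approx y))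
      (Close ε λ n → approx x n ℚ.⊔ approx y n)
      (λ m n → ⊔-near (approx x m) (approx y m) (approx x n) (approx y n))
      (cauchy x ε 0<ε) (cauchy y ε 0<ε)
  }

product : List ℝ → ℝ
product = foldr _*_ (fromℚ 1ℚ)

-- The order on ℝ is not decidable, so the insertion sort compares and
-- exchanges by ⊓ and ⊔.  By sort-approx, the n-th approximations of its output
-- are the n-th approximations of its input, sorted.

insert : ℝ → List ℝ → List ℝ
insert x []       = x ∷ []
insert x (y ∷ ys) = x ⊓ y ∷ insert (x ⊔ y) ys

sort : List ℝ → List ℝ
sort = foldr insert []

module ℚSort = InsertionSort ℚ.≤-decTotalOrder

private
  open SortedList (DecTotalOrder.totalOrder ℚ.≤-decTotalOrder) using (Sorted)
  open import Data.List.Sort.InsertionSort.Properties ℚ.≤-decTotalOrder using (sort-↗)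

  insert-≤ : ∀ p q qs → p ℚ.≤ q → ℚSort.insert p (q ∷ qs) ≡ p ∷ q ∷ qs
  insert-≤ p q qs p≤q = cong (if_then p ∷ q ∷ qs else q ∷ ℚSort.insert p qs)
    (dec-true (p ℚ.≤? q) p≤q)

  insert-≰ : ∀ p q qs → ¬ p ℚ.≤ q → ℚSort.insert p (q ∷ qs) ≡ q ∷ ℚSort.insert p qs
  insert-≰ p q qs p≰q = cong (if_then p ∷ q ∷ qs else q ∷ ℚSort.insert p qs)
    (dec-false (p ℚ.≤? q) p≰q)

  insert-min : ∀ p qs → Sorted (p ∷ qs) → ℚSort.insert p qs ≡ p ∷ qs
  insert-min p []       _         = ≡.refl
  insert-min p (q ∷ qs) (p≤q ∷ _) = insert-≤ p q qs p≤q

  insert-⊓⊔ : ∀ p q qs → Sorted (q ∷ qs) →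
              p ℚ.⊓ q ∷ ℚSort.insert (p ℚ.⊔ q) qs ≡ ℚSort.insert p (q ∷ qs)
  insert-⊓⊔ p q qs q∷qs↗ = case (p ℚ.≤? q)
    where
    case : Dec (p ℚ.≤ q) → _
    case (yes p≤q) = ≡.trans
      (cong₂ _∷_ (ℚ.p≤q⇒p⊓q≡p p≤q)
        (≡.trans (cong (λ r → ℚSort.insert r qs) (ℚ.p≤q⇒p⊔q≡q p≤q)) (insert-min q qs q∷qs↗)))
      (≡.sym (insert-≤ p q qs p≤q))
    case (no p≰q) = ≡.trans
      (cong₂ _∷_ (ℚ.p≥q⇒p⊓q≡q q≤p) (cong (λ r → ℚSort.insert r qs) (ℚ.p≥q⇒p⊔q≡p q≤p)))
      (≡.sym (insert-≰ p q qs p≰q))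
      where q≤p = ℚ.<⇒≤ (ℚ.≰⇒> p≰q)

  insert-approx : ∀ n x ys → Sorted (map (λ y → approx y n) ys) →
                  map (λ y → approx y n) (insert x ys) ≡
                  ℚSort.insert (approx x n) (map (λ y → approx y n) ys)
  insert-approx n x []       _  = ≡.refl
  insert-approx n x (y ∷ ys) ↗ = ≡.trans
    (cong (approx (x ⊓ y) n ∷_) (insert-approx n (x ⊔ y) ys (Linked.tail ↗)))
    (insert-⊓⊔ (approx x n) (approx y n) (map (λ y → approx y n) ys) ↗)

sort-approx : ∀ n xs → map (λ x → approx x n) (sort xs) ≡
                       ℚSort.sort (map (λ x → approx x n) xs)
sort-approx n []       = ≡.refl
sort-approx n (x ∷ xs) = ≡.trans
  (insert-approx n x (sort xs)
    (subst Sorted (≡.sym (sort-approx n xs)) (sort-↗ (map (λ x → approx x n) xs))))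
  (cong (ℚSort.insert (approx x n)) (sort-approx n xs))

infix 4 _≋_

_≋_ : List ℝ → List ℝ → Set
_≋_ = Pointwise _≃_

record Graph (n : ℕ) : Set₁ where
  field
    Adj     : Fin n → Fin n → Set
    adj?    : ∀ x y → Dec (Adj x y)
    sym     : ∀ {x y} → Adj x y → Adj y x
    irrefl  : ∀ {x} → ¬ Adj x x

open Graph public

record _≅_ {n₁ n₂} (G₁ : Graph n₁) (G₂ : Graph n₂) : Set where
  field
    bijection : Fin n₁ ⤖ Fin n₂

  open Bijection bijection public using (to)

  field
    adjacent  : ∀ x y → Adj G₁ x y ⇔ Adj G₂ (to x) (to y)

-- G - v, with v kept as an isolated vertex so that the vertex type stays
-- Fin n.  The edges, and the distances between the other vertices, are
-- those of G - v; nothing else about it is used.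

infixl 6 _-_

_-_ : ∀ {n} → Graph n → Fin n → Graph n
G - v = record
  { Adj    = λ x y → x ≢ v × y ≢ v × Adj G x y
  ; adj?   = λ x y → ¬? (x ≟ᶠ v) ×-dec ¬? (y ≟ᶠ v) ×-dec adj? G x y
  ; sym    = λ (x≢v , y≢v , xy) → y≢v , x≢v , sym G xy
  ; irrefl = λ (_ , _ , xx) → irrefl G xx
  }

data Walk {n} (G : Graph n) : ℕ → Fin n → Fin n → Set where
  []  : ∀ {x} → Walk G 0 x x
  _∷_ : ∀ {k x y z} → Adj G x y → Walk G k y z → Walk G (suc k) x z

walk? : ∀ {n} (G : Graph n) k x y → Dec (Walk G k x y)
walk? G zero    x y = map′ (λ { ≡.refl → [] }) (λ { [] → ≡.refl }) (x ≟ᶠ y)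
walk? G (suc k) x z = map′ (λ (_ , e , w) → e ∷ w) (λ { (e ∷ w) → _ , e , w })
  (any? λ y → adj? G x y ×-dec walk? G k y z)

-- `nothing` means infinite distance.  A shortest walk repeats no vertex, so
-- it has fewer than n edges and the search below finds it if there is any.

dist : ∀ {n} → Graph n → Fin n → Fin n → Maybe ℕ
dist {n} G x y = head (filter (λ k → walk? G k x y) (upTo n))

-- Finite sets of vertices are represented by duplicate-free lists.

pl : ∀ {n} → Graph n → (v t : Fin n) → (h : ℕ) → List (Fin n)
pl G v t 0 = []
pl G v t 1 with adj? G v t
... | yes _ = v ∷ []
... | no  _ = []
pl {n} G v t (suc (suc k)) = filter
  (λ u → adj? (G - v) u t ×-dec
         any? λ s → adj? G v s ×-dec ≡-dec ℕ._≟_ (dist (G - v) s u) (just k))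
  (allFin n)

record Triple (n : ℕ) : Set where
  constructor ⟨_at_,_⟩
  field
    hops    : ℕ
    count   : ℕ
    parents : List (Fin n)

triple : ∀ {n} → ℕ → List (Fin n) → List (Triple n)
triple h []         = []
triple h us@(_ ∷ _) = ⟨ h at length us , us ⟩ ∷ []

-- Finite distances are less than n, so pl G v t h is empty for h ≥ 2 + n.

HP : ∀ {n} → Graph n → (v t : Fin n) → List (Triple n)
HP {n} G v t with concatMap (λ h → triple h (pl G v t h)) (upTo (2 ℕ.+ n))
... | []         = ⟨ 0 at 0 , [] ⟩ ∷ []
... | ts@(_ ∷ _) = ts

pairs : ∀ {A : Set} → List A → List (A × A)
pairs []       = []
pairs (x ∷ xs) = map (x ,_) xs ++ pairs xs

-- Only evaluated on members of one parent list; these lie in a single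
-- component of G, so the default 0 is never used.

hopDistance : ∀ {n} → Graph n → Fin n × Fin n → ℕ
hopDistance G (x , y) = fromMaybe 0 (dist G x y)

AvPD : ∀ {n} → Graph n → ℝ → List (Fin n) → ℝ
AvPD G κ []             = κ
AvPD G κ (_ ∷ [])       = κ
AvPD G κ us@(_ ∷ _ ∷ _) =
  fromℚ (+ sum (map (hopDistance G) (pairs us)) ℚ./ length (pairs us))

module RSVP (𝒫 : ℕ → ℕ) (κ : ℝ) where

  factor : ∀ {n} → Graph n → Triple n → ℝ
  factor G ⟨ h at c , us ⟩ = AvPD G κ us * fromℕ (𝒫 h ℕ.^ c)

  𝒮 : ∀ {n} → Graph n → (v t : Fin n) → ℝ
  𝒮 G v t = product (map (factor G) (HP G v t))

  signature : ∀ {n} → Graph n → Fin n → List ℝ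
  signature {n} G v = sort (map (𝒮 G v) (allFin n))

{-# OPTIONS --safe #-}

-- An isomorphism f preserves distances, also after deleting v on one side and
-- f v on the other, so it carries each parent list of v → t to the
-- corresponding parent list of f v → f t, up to reordering.  As the average
-- pairwise distance does not depend on the order of the list, the factors
-- agree, and the two signatures sort the same numbers in different orders.

module Submission where

open import Defs
open import Data.Nat using (ℕ; _≤_)
open import Data.Nat.Primality using (Prime)
open import Data.Fin using (Fin)
open import Data.Product using (_×_)
open import Function.Definitions using (Injective)
open import Relation.Binary.PropositionalEquality using (_≡_)

open import Data.Fin.Properties using (any?)
open import Data.Integer using (+_)
open import Data.List
  using (List; []; _∷_; _++_; allFin; concatMap; filter; head; length; map; upTo)
open import Data.List.Membership.Propositional using (_∈_)
open import Data.List.Membership.Propositional.Properties using (∈-allFin; ∈-map⁺)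
open import Data.List.Membership.Propositional.Properties.WithK using (unique∧set⇒bag)
open import Data.List.Properties
  using (filter-≐; length-map; length-tabulate; map-++; map-cong; map-∘; ∷-injective)
open import Data.List.Relation.Binary.BagAndSetEquality using (∼bag⇒↭)
open import Data.List.Relation.Binary.Permutation.Propositional
  using (_↭_; prep; refl; swap; trans; ↭-refl; ↭⇒↭ₛ; module PermutationReasoning)
open import Data.List.Relation.Binary.Permutation.Propositional.Properties as Perm
  using (filter-↭; ↭-length)
open import Data.List.Relation.Binary.Pointwise as Pointwise using (Pointwise; []; _∷_)
open import Data.List.Relation.Unary.Sorted.TotalOrder.Properties using (↗↭↗⇒≋)
open import Data.List.Relation.Unary.Unique.Propositional.Properties as Unique using (allFin⁺)
open import Data.List.Sort.InsertionSort.Properties using (sort-↗; sort-↭)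
open import Data.Maybe using (just; fromMaybe)
open import Data.Maybe.Properties using (≡-dec)
import Data.Nat as ℕ
open import Data.Nat using (NonZero; suc)
open import Data.Nat.ListAction.Properties using (sum-↭)
open import Data.Product using (∃-syntax; _,_; proj₁; proj₂)
import Data.Product as Product
open import Data.Rational as ℚ using (ℚ)
import Data.Rational.Properties as ℚ
open import Function using (_∘_; mk⇔)
open import Function.Bundles using (module Bijection; module Equivalence)
open import Level using (0ℓ)
open import Relation.Binary.Bundles using (module DecTotalOrder)
open import Relation.Binary.PropositionalEquality as ≡
  using (cong; cong₂; subst; subst₂; module ≡-Reasoning)
open import Relation.Nullary using (yes; no; contradiction)
open import Relation.Nullary.Decidable using (_×-dec_)
open import Relation.Unary using (Pred; Decidable)

private
  variable
    A B : Set
    n n₁ n₂ : ℕ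

-- Lists

filter-map : ∀ {P : Pred B 0ℓ} (P? : Decidable P) (f : A → B) xs →
             filter P? (map f xs) ≡ map f (filter (P? ∘ f) xs)
filter-map P? f []       = ≡.refl
filter-map P? f (x ∷ xs) with P? (f x)
... | yes _ = cong (f x ∷_) (filter-map P? f xs)
... | no  _ = filter-map P? f xs

concatMap⁺ : ∀ {R : A → B → Set} {f g} → (∀ k → Pointwise R (f k) (g k)) →
             (ks : List ℕ) → Pointwise R (concatMap f ks) (concatMap g ks)
concatMap⁺ f~g ks = Pointwise.concat⁺ (Pointwise.map⁺ _ _ (Pointwise.refl (λ {k} → f~g k) {ks}))

pairs-map : (f : A → B) (xs : List A) →
            pairs (map f xs) ≡ map (Product.map f f) (pairs xs)
pairs-map f []       = ≡.refl
pairs-map f (x ∷ xs) = begin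
  map (f x ,_) (map f xs) ++ pairs (map f xs)
    -- Both sides fuse to the map `λ y → (f x , f y)` over `xs`.
    ≡⟨ cong₂ _++_ (≡.trans (≡.sym (map-∘ xs)) (map-∘ xs)) (pairs-map f xs) ⟩
  map (Product.map f f) (map (x ,_) xs) ++ map (Product.map f f) (pairs xs)
    ≡⟨ map-++ _ (map (x ,_) xs) (pairs xs) ⟨
  map (Product.map f f) (pairs (x ∷ xs)) ∎
  where open ≡-Reasoning

module _ (g : A × A → B) (g-sym : ∀ x y → g (x , y) ≡ g (y , x)) where

  private
    star : A → List A → List B
    star x = map (λ y → g (x , y))

    image : List A → List B
    image xs = map g (pairs xs)

    image-∷ : ∀ x xs → image (x ∷ xs) ≡ star x xs ++ image xs
    image-∷ x xs = ≡.trans (map-++ g (map (x ,_) xs) (pairs xs))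
                           (cong (_++ image xs) (≡.sym (map-∘ xs)))

    image-∷∷ : ∀ x y xs → image (x ∷ y ∷ xs) ≡ g (x , y) ∷ star x xs ++ star y xs ++ image xs
    image-∷∷ x y xs = ≡.trans (image-∷ x (y ∷ xs))
                              (cong (λ zs → g (x , y) ∷ star x xs ++ zs) (image-∷ y xs))

  -- Swapping the first two entries turns only the pair `(x , y)` around, which `g-sym` absorbs; the
  -- remaining pairs just move between blocks.
  map-pairs-↭ : ∀ {xs ys} → xs ↭ ys → map g (pairs xs) ↭ map g (pairs ys)
  map-pairs-↭ refl = ↭-refl
  map-pairs-↭ (trans p q) = trans (map-pairs-↭ p) (map-pairs-↭ q)
  map-pairs-↭ (prep {xs} {ys} x p) = begin
    image (x ∷ xs)         ≡⟨ image-∷ x xs ⟩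
    star x xs ++ image xs  ↭⟨ Perm.++⁺ (Perm.map⁺ _ p) (map-pairs-↭ p) ⟩
    star x ys ++ image ys  ≡⟨ image-∷ x ys ⟨
    image (x ∷ ys)         ∎
    where open PermutationReasoning
  map-pairs-↭ (swap {xs} {ys} x y p) = begin
    image (x ∷ y ∷ xs)
      ≡⟨ image-∷∷ x y xs ⟩
    g (x , y) ∷ star x xs ++ star y xs ++ image xs
      ≡⟨ cong (_∷ star x xs ++ star y xs ++ image xs) (g-sym x y) ⟩
    g (y , x) ∷ star x xs ++ star y xs ++ image xs
      ↭⟨ prep _ (Perm.shifts (star x xs) (star y xs)) ⟩
    g (y , x) ∷ star y xs ++ star x xs ++ image xs
      ↭⟨ prep _ (Perm.++⁺ (Perm.map⁺ _ p) (Perm.++⁺ (Perm.map⁺ _ p) (map-pairs-↭ p))) ⟩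
    g (y , x) ∷ star y ys ++ star x ys ++ image ys
      ≡⟨ image-∷∷ y x ys ⟨
    image (y ∷ x ∷ ys) ∎
    where open PermutationReasoning

-- Sorting real numbers

approx-≡⇒≃ : ∀ x y → (∀ n → approx x n ≡ approx y n) → x ≃ y
approx-≡⇒≃ x y x≡y ε 0<ε = 0 , λ n _ →
  subst (λ q → ℚ.∣ q ∣ ℚ.< ε)
    (≡.trans (≡.sym (ℚ.+-inverseʳ (approx x n))) (cong (λ q → approx x n ℚ.- q) (x≡y n))) 0<ε

approx-≡⇒≋ : ∀ xs ys →
             (∀ n → map (λ x → approx x n) xs ≡ map (λ y → approx y n) ys) → xs ≋ ys
approx-≡⇒≋ []       []       _     = []
-- A difference in length already shows at index 0.
approx-≡⇒≋ []       (_ ∷ _)  xs≡ys with () ← xs≡ys 0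
approx-≡⇒≋ (_ ∷ _)  []       xs≡ys with () ← xs≡ys 0
approx-≡⇒≋ (x ∷ xs) (y ∷ ys) xs≡ys =
  approx-≡⇒≃ x y (proj₁ ∘ ∷-injective ∘ xs≡ys) ∷ approx-≡⇒≋ xs ys (proj₂ ∘ ∷-injective ∘ xs≡ys)

-- The order on `ℚ` is antisymmetric, so a list has only one sorted rearrangement.
ℚsort-cong-↭ : ∀ {ps qs} → ps ↭ qs → ℚSort.sort ps ≡ ℚSort.sort qs
ℚsort-cong-↭ {ps} {qs} ps↭qs = Pointwise.Pointwise-≡⇒≡
  (↗↭↗⇒≋ (DecTotalOrder.totalOrder O) (sort-↗ O ps) (sort-↗ O qs) (↭⇒↭ₛ (begin
    ℚSort.sort ps  ↭⟨ sort-↭ O ps ⟩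
    ps             ↭⟨ ps↭qs ⟩
    qs             ↭⟨ sort-↭ O qs ⟨
    ℚSort.sort qs  ∎)))
  where
  open PermutationReasoning
  O = ℚ.≤-decTotalOrder

-- With no decidable order on `ℝ`, the argument runs separately at each index `n`, where `sort` acts
-- as the ordinary sort of rationals.
sort-cong-↭ : ∀ {xs ys} → xs ↭ ys → sort xs ≋ sort ys
sort-cong-↭ {xs} {ys} xs↭ys = approx-≡⇒≋ (sort xs) (sort ys) λ n → begin
  map (λ x → approx x n) (sort xs)         ≡⟨ sort-approx n xs ⟩
  ℚSort.sort (map (λ x → approx x n) xs)   ≡⟨ ℚsort-cong-↭ (Perm.map⁺ _ xs↭ys) ⟩
  ℚSort.sort (map (λ x → approx x n) ys)   ≡⟨ sort-approx n ys ⟨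
  map (λ x → approx x n) (sort ys)         ∎
  where open ≡-Reasoning

-- Distances and their averages

module _ (G : Graph n) where

  snoc : ∀ {k x y z} → Walk G k x y → Adj G y z → Walk G (suc k) x z
  snoc []       e = e ∷ []
  snoc (d ∷ w)  e = d ∷ snoc w e

  reverse : ∀ {k x y} → Walk G k x y → Walk G k y x
  reverse []      = []
  reverse (e ∷ w) = snoc (reverse w) (sym G e)

  -- Reversing walks shows that the same lengths pass both filters, so the first one is the same.
  dist-sym : ∀ x y → dist G x y ≡ dist G y x
  dist-sym x y = cong head
    (filter-≐ (λ k → walk? G k x y) (λ k → walk? G k y x) (reverse , reverse) (upTo n))

module _ {G₁ : Graph n₁} {G₂ : Graph n₂} (κ : ℝ) where

  private
    -- The nonzero instances depend on the denominators, so `cong₂` does not apply; they are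
    -- irrelevant, so matching on `≡.refl` suffices.
    /-cong : ∀ {a b c d} .{{_ : NonZero c}} .{{_ : NonZero d}} → a ≡ b → c ≡ d →
             + a ℚ./ c ≡ + b ℚ./ d
    /-cong ≡.refl ≡.refl = ≡.refl

  -- Equal lengths select the same clause of `AvPD`; in the last one only the sum and the number of
  -- distances enter. Equality is `≡`, not just `≃`, because the average is an exact rational.
  AvPD-cong : ∀ us ws → length us ≡ length ws →
              map (hopDistance G₁) (pairs us) ↭ map (hopDistance G₂) (pairs ws) →
              AvPD G₁ κ us ≡ AvPD G₂ κ ws
  AvPD-cong []              []              _ _ = ≡.refl
  AvPD-cong (_ ∷ [])        (_ ∷ [])        _ _ = ≡.refl
  AvPD-cong us@(_ ∷ _ ∷ _)  ws@(_ ∷ _ ∷ _)  _ p = cong fromℚ (/-cong (sum-↭ p)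
    (subst₂ _≡_ (length-map _ (pairs us)) (length-map _ (pairs ws)) (↭-length p)))

-- Transport along an isomorphism

module _ {G₁ : Graph n₁} {G₂ : Graph n₂} (f : G₁ ≅ G₂) where

  open _≅_ f

  to-injective : ∀ {x y} → to x ≡ to y → x ≡ y
  to-injective = Bijection.injective bijection

  Adj-to : ∀ {x y} → Adj G₁ x y → Adj G₂ (to x) (to y)
  Adj-to = Equivalence.to (adjacent _ _)

  Adj-from : ∀ {x y} → Adj G₂ (to x) (to y) → Adj G₁ x y
  Adj-from = Equivalence.from (adjacent _ _)

  onto : ∀ y → ∃[ x ] to x ≡ y
  onto = Bijection.strictlySurjective bijection

  -- Both lists are duplicate-free and contain every vertex, the left one by surjectivity.
  allFin-↭ : map to (allFin n₁) ↭ allFin n₂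
  allFin-↭ = ∼bag⇒↭ (unique∧set⇒bag (Unique.map⁺ to-injective (allFin⁺ n₁)) (allFin⁺ n₂)
    (λ {y} → mk⇔ (λ _ → ∈-allFin y)
      (λ _ → let x , to[x]≡y = onto y in subst (_∈ _) to[x]≡y (∈-map⁺ to (∈-allFin x)))))

  -- Needed because the number of vertices bounds the search in `dist` and the hop distances in
  -- `HP`.
  size-≡ : n₁ ≡ n₂
  size-≡ = begin
    n₁                           ≡⟨ length-tabulate (λ x → x) ⟨
    length (allFin n₁)           ≡⟨ length-map to (allFin n₁) ⟨
    length (map to (allFin n₁))  ≡⟨ ↭-length allFin-↭ ⟩
    length (allFin n₂)           ≡⟨ length-tabulate (λ x → x) ⟩
    n₂                           ∎
    where open ≡-Reasoning

  Walk-to : ∀ {k x y} → Walk G₁ k x y → Walk G₂ k (to x) (to y)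
  Walk-to []      = []
  Walk-to (e ∷ w) = Adj-to e ∷ Walk-to w

  Walk-from : ∀ {k x y} → Walk G₂ k (to x) (to y) → Walk G₁ k x y
  Walk-from = go ≡.refl ≡.refl
    where
    -- The inner vertices of a walk in `G₂` are not of the form `to z` on the nose, so the endpoints
    -- are generalized and preimages chosen step by step.
    go : ∀ {k x y a b} → to x ≡ a → to y ≡ b → Walk G₂ k a b → Walk G₁ k x y
    go to[x]≡a to[y]≡a [] =
      subst (Walk G₁ 0 _) (to-injective (≡.trans to[x]≡a (≡.sym to[y]≡a))) []
    go ≡.refl to[y]≡b (_∷_ {y = c} e w) =
      let z , to[z]≡c = onto c
      in Adj-from (subst (Adj G₂ _) (≡.sym to[z]≡c) e) ∷ go to[z]≡c to[y]≡b w

  dist-to : ∀ x y → dist G₁ x y ≡ dist G₂ (to x) (to y)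
  dist-to x y = cong head (≡.trans
    (filter-≐ (λ k → walk? G₁ k x y) walk₂? (Walk-to , Walk-from) (upTo n₁))
    (cong (filter walk₂? ∘ upTo) size-≡))
    where
    walk₂? : Decidable (λ k → Walk G₂ k (to x) (to y))
    walk₂? k = walk? G₂ k (to x) (to y)

  -- Since `v` stays as an isolated vertex, the same bijection serves, and `dist-to` applies to the
  -- deleted graphs.
  delete : ∀ v → (G₁ - v) ≅ (G₂ - to v)
  delete v = record
    { bijection = bijection
    ; adjacent  = λ x y → mk⇔
        (λ (x≢v , y≢v , xy) → x≢v ∘ to-injective , y≢v ∘ to-injective , Adj-to xy)
        (λ (x≢v , y≢v , xy) → x≢v ∘ cong to , y≢v ∘ cong to , Adj-from xy)
    }

-- Average distances and parent lists under an isomorphism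

module _ {G₁ : Graph n₁} {G₂ : Graph n₂} (f : G₁ ≅ G₂) where

  open _≅_ f

  AvPD-to : ∀ κ us ws → map to us ↭ ws → AvPD G₁ κ us ≡ AvPD G₂ κ ws
  AvPD-to κ us ws p = AvPD-cong κ us ws
    (≡.trans (≡.sym (length-map to us)) (↭-length p)) (begin
      map (hopDistance G₁) (pairs us)
        ≡⟨ map-cong (λ (x , y) → cong (fromMaybe 0) (dist-to f x y)) (pairs us) ⟩
      map (hopDistance G₂ ∘ Product.map to to) (pairs us)
        ≡⟨ map-∘ (pairs us) ⟩
      map (hopDistance G₂) (map (Product.map to to) (pairs us))
        ≡⟨ cong (map (hopDistance G₂)) (pairs-map to us) ⟨
      map (hopDistance G₂) (pairs (map to us))
        -- Reordering may turn pairs around, hence the symmetry of the distance.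
        ↭⟨ map-pairs-↭ (hopDistance G₂) (λ x y → cong (fromMaybe 0) (dist-sym G₂ x y)) p ⟩
      map (hopDistance G₂) (pairs ws) ∎)
    where open PermutationReasoning

  -- Only a permutation, since `to` need not respect the order of `allFin` in which parents are
  -- listed.
  pl-to : ∀ v t h → map to (pl G₁ v t h) ↭ pl G₂ (to v) (to t) h
  pl-to v t 0 = ↭-refl
  pl-to v t 1 with adj? G₁ v t | adj? G₂ (to v) (to t)
  ... | yes _ | yes _  = ↭-refl
  ... | no  _ | no  _  = ↭-refl
  ... | yes e | no  ¬e = contradiction (Adj-to f e) ¬e
  ... | no ¬e | yes e  = contradiction (Adj-from f e) ¬e
  pl-to v t (suc (suc k)) = begin
    map to (filter parent₁? (allFin n₁))
      ≡⟨ cong (map to) (filter-≐ parent₁? (parent₂? ∘ to) (parent-to , parent-from) (allFin n₁)) ⟩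
    map to (filter (parent₂? ∘ to) (allFin n₁))
      ≡⟨ filter-map parent₂? to (allFin n₁) ⟨
    filter parent₂? (map to (allFin n₁))
      ↭⟨ filter-↭ parent₂? (allFin-↭ f) ⟩
    filter parent₂? (allFin n₂) ∎
    where
    open PermutationReasoning

    Parent : ∀ {n} → Graph n → (v t u : Fin n) → Set
    Parent G v t u = Adj (G - v) u t × ∃[ s ] (Adj G v s × dist (G - v) s u ≡ just k)

    -- The same decision procedure as in `pl`, so that `pl` unfolds to a filter by it.
    parent? : ∀ {n} (G : Graph n) v t → Decidable (Parent G v t)
    parent? G v t u = adj? (G - v) u t ×-dec
      any? λ s → adj? G v s ×-dec ≡-dec ℕ._≟_ (dist (G - v) s u) (just k)

    parent₁? = parent? G₁ v t
    parent₂? = parent? G₂ (to v) (to t)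

    dist-v : ∀ s u → dist (G₁ - v) s u ≡ dist (G₂ - to v) (to s) (to u)
    dist-v = dist-to (delete f v)

    parent-to : ∀ {u} → Parent G₁ v t u → Parent G₂ (to v) (to t) (to u)
    parent-to {u} (e , s , vs , d) =
      Adj-to (delete f v) e , to s , Adj-to f vs , ≡.trans (≡.sym (dist-v s u)) d

    parent-from : ∀ {u} → Parent G₂ (to v) (to t) (to u) → Parent G₁ v t u
    -- The start vertex `s′` is arbitrary in `G₂`; surjectivity supplies its preimage.
    parent-from {u} (e , s′ , vs′ , d) with s , ≡.refl ← onto f s′ =
      Adj-from (delete f v) e , s , Adj-from f vs′ , ≡.trans (dist-v s u) d

  -- Corresponding lists of hop triples

  infix 4 _~_

  data _~_ : Triple n₁ → Triple n₂ → Set where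
    ⟨_at_,_⟩ : ∀ h c {us ws} → map to us ↭ ws → ⟨ h at c , us ⟩ ~ ⟨ h at c , ws ⟩

  triple-~ : ∀ h us ws → map to us ↭ ws → Pointwise _~_ (triple h us) (triple h ws)
  triple-~ h us ws p = go us ws p (≡.trans (≡.sym (length-map to us)) (↭-length p))
    where
    -- The length equation excludes that just one list is empty, and it identifies the counts.
    go : ∀ us ws → map to us ↭ ws → length us ≡ length ws →
         Pointwise _~_ (triple h us) (triple h ws)
    go []          []          _ _ = []
    go us@(_ ∷ _)  ws@(_ ∷ _)  p e =
      subst (λ c → ⟨ h at length us , us ⟩ ~ ⟨ h at c , ws ⟩) e ⟨ h at length us , p ⟩ ∷ []

  private
    -- The bound `m` is kept apart from `n`, so that it can be rewritten along `size-≡` while the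
    -- graph stays fixed.
    triples : ∀ {n} → Graph n → (v t : Fin n) → ℕ → List (Triple n)
    triples G v t m = concatMap (λ h → triple h (pl G v t h)) (upTo (2 ℕ.+ m))

  triples-~ : ∀ v t → Pointwise _~_ (triples G₁ v t n₁) (triples G₂ (to v) (to t) n₂)
  triples-~ v t = subst
    (λ m → Pointwise _~_ (triples G₁ v t n₁) (triples G₂ (to v) (to t) m)) (size-≡ f)
    (concatMap⁺ (λ h → triple-~ h _ _ (pl-to v t h)) (upTo (2 ℕ.+ n₁)))

  HP-~ : ∀ v t → Pointwise _~_ (HP G₁ v t) (HP G₂ (to v) (to t))
  HP-~ v t with triples G₁ v t n₁ | triples G₂ (to v) (to t) n₂ | triples-~ v t
  -- The relation forces both lists to be empty together, so the default triple appears on both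
  -- sides or on neither.
  ... | []    | []    | []     = ⟨ 0 at 0 , ↭-refl ⟩ ∷ []
  ... | _ ∷ _ | _ ∷ _ | r ∷ rs = r ∷ rs

  -- Values and signatures

  module _ (𝒫 : ℕ → ℕ) (κ : ℝ) where

    open RSVP 𝒫 κ

    factor-to : ∀ {t₁ t₂} → t₁ ~ t₂ → factor G₁ t₁ ≡ factor G₂ t₂
    factor-to (⟨_at_,_⟩ _ _ {us} {ws} p) rewrite AvPD-to κ us ws p = ≡.refl

    𝒮-to : ∀ v t → 𝒮 G₁ v t ≡ 𝒮 G₂ (to v) (to t)
    𝒮-to v t = cong product
      (Pointwise.Pointwise-≡⇒≡ (Pointwise.map⁺ _ _ (Pointwise.map factor-to (HP-~ v t))))

    𝒮s-↭ : ∀ v → map (𝒮 G₁ v) (allFin n₁) ↭ map (𝒮 G₂ (to v)) (allFin n₂)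
    𝒮s-↭ v = begin
      map (𝒮 G₁ v) (allFin n₁)                ≡⟨ map-cong (𝒮-to v) (allFin n₁) ⟩
      map (𝒮 G₂ (to v) ∘ to) (allFin n₁)      ≡⟨ map-∘ (allFin n₁) ⟩
      map (𝒮 G₂ (to v)) (map to (allFin n₁))  ↭⟨ Perm.map⁺ _ (allFin-↭ f) ⟩
      map (𝒮 G₂ (to v)) (allFin n₂)           ∎
      where open PermutationReasoning

theorem1 : (𝒫 : ℕ → ℕ) → Injective _≡_ _≡_ 𝒫 → (∀ h → Prime (𝒫 h) × 3 ≤ 𝒫 h) →
    (κ : ℝ) →
    ∀ {n₁ n₂} (G₁ : Graph n₁) (G₂ : Graph n₂) (f : G₁ ≅ G₂) →
    (v : Fin n₁) (w : Fin n₂) → _≅_.to f v ≡ w →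
    RSVP.signature 𝒫 κ G₁ v ≋ RSVP.signature 𝒫 κ G₂ w
theorem1 𝒫 _ _ κ G₁ G₂ f v w ≡.refl = sort-cong-↭ (𝒮s-↭ f 𝒫 κ v)
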